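{- Let $n \ge 2$ be an integer, let $k \ge 0$ be an integer, and let $P_n$ be the path on $n$ vertices. Then $$\gamma_{\rm esp}(P_n)=\begin{cases} 2k & \text{if } n=4k,\\ 2k+1 & \text{if } n=4k+1,\\ 2k+2 & \text{if } n=4k+2 \text{ or } n=4k+3.\end{cases}$$
   Context: Graphs are finite, simple and undirected. For a graph $G=(V,E)$ and $S\subseteq V$, write $\overline{S}=V\setminus S$, and let $N(v)$ be the open neighbourhood of $v$. A set $S \subseteq V$ is an end super dominating set (ESD-set) of $G$ if for every $u\in\overline{S}$ there exists $v\in S$ with $N(v)\cap\overline{S}=\{u\}$, and moreover $\deg(u)\ge 2$ for every $u\in\overline{S}$. (Such a set is in particular a dominating set.) The end super domination number $\gamma_{\rm esp}(G)$ is the minimum cardinality of an ESD-set of $G$. -}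

module Defs where

open import Level using (Level; 0ℓ)
open import Data.Bool.Properties using () renaming (_≟_ to _≟ᵇ_)
open import Data.Empty using (⊥-elim)
open import Data.Fin using (Fin; toℕ)
open import Data.Fin.Properties using (any?; all?)
open import Data.Fin.Subset using (Subset; _∈_; ∁; _∩_; ⁅_⁆; ∣_∣; ⊤)
open import Data.Fin.Subset.Properties using (_∈?_; ∈⊤; x∈p⇒x∉∁p; anySubset?)
open import Data.Nat using (ℕ; zero; suc; _≤_; z≤n; s≤s; _≤?_; _≟_)
open import Data.Nat.Properties using (1+n≢n)
open import Data.Product using (∃; ∃-syntax; _×_; _,_; proj₁)
open import Data.Sum using (_⊎_; inj₁; inj₂; swap)
open import Data.Vec using (tabulate)
open import Data.Vec.Properties using (≡-dec)
open import Relation.Binary using (Rel; Symmetric; Irreflexive) renaming (Decidable to Decidable₂)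
open import Relation.Binary.PropositionalEquality using (_≡_; refl; sym)
open import Relation.Nullary using (yes; no; does)
open import Relation.Nullary.Decidable using (_×-dec_; _⊎-dec_; _→-dec_)
open import Relation.Unary using (Pred; Decidable)

private
  variable
    ℓ : Level
    n : ℕ

record Graph (n : ℕ) : Set₁ where
  field
    Adj   : Rel (Fin n) 0ℓ
    adj?  : Decidable₂ Adj
    symm  : Symmetric Adj
    irrfl : Irreflexive _≡_ Adj

  N : Fin n → Subset n
  N v = tabulate (λ u → does (adj? v u))

  deg : Fin n → ℕ
  deg v = ∣ N v ∣

module _ (G : Graph n) where
  open Graph G

  IsESD : Subset n → Set
  IsESD S = ∀ u → u ∈ ∁ S → (∃[ v ] v ∈ S × N v ∩ ∁ S ≡ ⁅ u ⁆) × 2 ≤ deg u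

  isESD? : Decidable IsESD
  isESD? S = all? λ u → (u ∈? ∁ S) →-dec
    (any? (λ v → (v ∈? S) ×-dec ≡-dec _≟ᵇ_ (N v ∩ ∁ S) ⁅ u ⁆) ×-dec (2 ≤? deg u))

  ⊤-isESD : IsESD ⊤
  ⊤-isESD u u∈∁⊤ = ⊥-elim (x∈p⇒x∉∁p ∈⊤ u∈∁⊤)

  ESDCard : ℕ → Set
  ESDCard m = ∃[ S ] IsESD S × ∣ S ∣ ≡ m

  esdCard? : Decidable ESDCard
  esdCard? m = anySubset? (λ S → isESD? S ×-dec (∣ S ∣ ≟ m))

IsLeast : Pred ℕ ℓ → ℕ → Set ℓ
IsLeast P m = P m × (∀ j → P j → m ≤ j)

least : (P : Pred ℕ ℓ) → Decidable P → ∀ m → P m → ∃ (IsLeast P)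
least P P? m pm with P? 0
... | yes p0 = 0 , p0 , λ _ _ → z≤n
least P P? zero    pm | no ¬p0 = ⊥-elim (¬p0 pm)
least P P? (suc m) pm | no ¬p0
  with least (λ i → P (suc i)) (λ i → P? (suc i)) m pm
... | k , pk , k≤ = suc k , pk , λ { zero    p0 → ⊥-elim (¬p0 p0)
                                   ; (suc j) pj → s≤s (k≤ j pj) }

esdNumber : (G : Graph n) → ∃ (IsLeast (ESDCard G))
esdNumber {n} G = least (ESDCard G) (esdCard? G) ∣ ⊤ {n} ∣ (⊤ , ⊤-isESD G , refl)

γesp : Graph n → ℕ
γesp G = proj₁ (esdNumber G)

path : ∀ n → Graph n
path n = record
  { Adj   = λ i j → toℕ j ≡ suc (toℕ i) ⊎ toℕ i ≡ suc (toℕ j)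
  ; adj?  = λ i j → (toℕ j ≟ suc (toℕ i)) ⊎-dec (toℕ i ≟ suc (toℕ j))
  ; symm  = swap
  ; irrfl = λ { refl (inj₁ e) → 1+n≢n (sym e) ; refl (inj₂ e) → 1+n≢n (sym e) }
  }

{-# OPTIONS --safe #-}

-- Read S as a word of bits, extended by "true" on both sides.  S is an ESD-set
-- of the path exactly when its end vertices lie in S and every false bit is
-- followed or preceded by two true bits.  Scanning such a word from the left,
-- the only way to have as few as half the bits true is the repeated block
-- true false false true; a leftover forces the extra vertices of the formula.
module Submission where

open import Defs
open import Data.Bool using (Bool; true; false)
open import Data.Empty using (⊥-elim)
open import Data.Fin using (Fin; zero; suc; toℕ; fromℕ<; inject₁)
open import Data.Fin.Properties using (toℕ-injective; toℕ-fromℕ<; toℕ-inject₁; toℕ<n)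
open import Data.Fin.Subset using (Subset; _∈_; ∁; _∩_; ⁅_⁆; ∣_∣; _-_)
open import Data.Fin.Subset.Properties
  using (x∈⁅x⁆; x∈⁅y⁆⇒x≡y; x∈p∩q⁺; x∈p∩q⁻; x∉p⇒x∈∁p; x∈∁p⇒x∉p; ⊆-antisym;
         p⊆q⇒∣p∣≤∣q∣; ∣⁅x⁆∣≡1; nonempty?; Empty-unique; ∣⊥∣≡0; x∈p⇒∣p-x∣<∣p∣;
         x∈p∧x≢y⇒x∈p-y)
open import Data.Nat
  using (ℕ; zero; suc; _+_; _*_; _≤_; _<_; z≤n; s≤s; s<s; ⌈_/2⌉)
open import Data.Nat.Properties
  using (≤-antisym; ≤-trans; ≤-refl; ≤-reflexive; suc-injective; <⇒≱; ≤∧≢⇒<;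
         m≢1+n+m)
open import Data.Nat.Tactic.RingSolver using (solve-∀)
open import Data.Product using (_×_; _,_; proj₁; proj₂; ∃-syntax)
open import Data.Sum using (_⊎_; inj₁; inj₂)
open import Data.Vec using (Vec; []; _∷_; here; there)
open import Data.Vec.Properties using ([]=⇒lookup; lookup⇒[]=; lookup∘tabulate)
open import Relation.Binary.PropositionalEquality
  using (_≡_; _≢_; refl; sym; trans; cong; subst)
open import Relation.Nullary using (yes; no; does; Dec)
open import Relation.Nullary.Decidable using (dec-true)

private
  variable
    m n : ℕ

-- Cardinalities of subsets, and neighbourhoods expressed by adjacency.

∣p∣≤1 : (p : Subset n) → (∀ {x y} → x ∈ p → y ∈ p → x ≡ y) → ∣ p ∣ ≤ 1
∣p∣≤1 {n} p unique with nonempty? p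
... | yes (x , x∈p) = ≤-trans
  (p⊆q⇒∣p∣≤∣q∣ λ y∈p → subst (_∈ ⁅ x ⁆) (unique x∈p y∈p) (x∈⁅x⁆ x))
  (≤-reflexive (∣⁅x⁆∣≡1 x))
... | no empty rewrite Empty-unique empty | ∣⊥∣≡0 n = z≤n

2≤∣p∣ : (p : Subset n) {x y : Fin n} → x ∈ p → y ∈ p → y ≢ x → 2 ≤ ∣ p ∣
2≤∣p∣ p {x} {y} x∈p y∈p y≢x =
  ≤-trans (s≤s (≤-trans (s≤s z≤n) (x∈p⇒∣p-x∣<∣p∣ y∈p-x))) (x∈p⇒∣p-x∣<∣p∣ x∈p)
  where
  y∈p-x : y ∈ p - x
  y∈p-x = x∈p∧x≢y⇒x∈p-y y∈p y≢x

module _ (G : Graph n) where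
  open Graph G

  ∈N⁺ : ∀ {v w} → Adj v w → w ∈ N v
  ∈N⁺ {v} {w} vw = lookup⇒[]= w (N v) (trans (lookup∘tabulate _ w) (dec-true (adj? v w) vw))

  ∈N⁻ : ∀ {v w} → w ∈ N v → Adj v w
  ∈N⁻ {v} {w} w∈N = witness (adj? v w) (trans (sym (lookup∘tabulate _ w)) ([]=⇒lookup w∈N))
    where
    witness : (a? : Dec (Adj v w)) → does a? ≡ true → Adj v w
    witness (yes a) _ = a

  -- Trades the set equation for adjacency plus uniqueness, so that on the path only positions need
  -- comparing.
  N∩∁≡⁅⁆⁺ : ∀ {S u v} → Adj v u → u ∈ ∁ S → (∀ {w} → Adj v w → w ∈ ∁ S → w ≡ u) →
            N v ∩ ∁ S ≡ ⁅ u ⁆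
  N∩∁≡⁅⁆⁺ {S} {u} {v} vu u∉S only = ⊆-antisym
    (λ w∈ → let w∈N , w∉S = x∈p∩q⁻ (N v) (∁ S) w∈ in
            subst (_∈ ⁅ u ⁆) (sym (only (∈N⁻ w∈N) w∉S)) (x∈⁅x⁆ u))
    (λ w∈ → subst (_∈ N v ∩ ∁ S) (sym (x∈⁅y⁆⇒x≡y u w∈)) (x∈p∩q⁺ (∈N⁺ vu , u∉S)))

  N∩∁≡⁅⁆⁻ : ∀ {S u v} → N v ∩ ∁ S ≡ ⁅ u ⁆ →
            Adj v u × (∀ {w} → Adj v w → w ∈ ∁ S → w ≡ u)
  N∩∁≡⁅⁆⁻ {S} {u} {v} eq =
    ∈N⁻ (proj₁ (x∈p∩q⁻ (N v) (∁ S) (subst (u ∈_) (sym eq) (x∈⁅x⁆ u)))) ,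
    λ {w} vw w∉S → x∈⁅y⁆⇒x≡y u (subst (w ∈_) eq (x∈p∩q⁺ (∈N⁺ vw , w∉S)))

-- Subsets as words of bits, and the local matching condition.

-- Positions past the end of the vector read as true.
bit : Vec Bool n → ℕ → Bool
bit []       _       = true
bit (b ∷ _)  zero    = b
bit (_ ∷ bs) (suc i) = bit bs i

bit-∈ : ∀ {S : Subset n} {u} → u ∈ S → bit S (toℕ u) ≡ true
bit-∈ here        = refl
bit-∈ (there u∈S) = bit-∈ u∈S

∈-bit : ∀ (S : Subset n) u → bit S (toℕ u) ≡ true → u ∈ S
∈-bit (true ∷ S) zero    refl = here
∈-bit (b ∷ S)    (suc u) eq   = there (∈-bit S u eq)

bit-∁ : ∀ {S : Subset n} {u} → u ∈ ∁ S → bit S (toℕ u) ≡ false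
bit-∁ {S = S} {u} u∉S with bit S (toℕ u) in eq
... | true  = ⊥-elim (x∈∁p⇒x∉p u∉S (∈-bit S u eq))
... | false = refl

∁-bit : ∀ (S : Subset n) u → bit S (toℕ u) ≡ false → u ∈ ∁ S
∁-bit S u eq = x∉p⇒x∈∁p λ u∈S → true≢false (trans (sym (bit-∈ u∈S)) eq)
  where
  true≢false : true ≢ false
  true≢false ()

bit-false⇒vertex : ∀ (S : Subset n) i → bit S i ≡ false → ∃[ u ] toℕ u ≡ i × u ∈ ∁ S
bit-false⇒vertex S i eq = u , u≡i , ∁-bit S u (trans (cong (bit S) u≡i) eq)
  where
  inRange : ∀ {n} (S : Subset n) i → bit S i ≡ false → i < n
  inRange (_ ∷ _) zero    _  = s≤s z≤n
  inRange (_ ∷ S) (suc i) eq = s<s (inRange S i eq)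
  u   = fromℕ< (inRange S i eq)
  u≡i = toℕ-fromℕ< (inRange S i eq)

-- The first two bits only serve as left context: the condition is imposed on
-- the other bits.
Local : Vec Bool (2 + n) → Set
Local {n} bs = ∀ i → bit bs (2 + i) ≡ false →
  suc i < n × ((bit bs (3 + i) ≡ true × bit bs (4 + i) ≡ true) ⊎
               (bit bs (1 + i) ≡ true × bit bs i ≡ true))

-- Each condition reads at most two bits to either side, so dropping the head only shifts indices;
-- the first constrained bit becomes left context.
Local-tail : ∀ {b} {bs : Vec Bool (2 + n)} → Local (b ∷ bs) → Local bs
Local-tail loc i eq with loc (suc i) eq
... | s<s i<n , ok = i<n , ok

-- ESD-sets of the path versus the local condition.

module _ {n : ℕ} where
  open Graph (path n)

  -- At either end of the path all neighbours share one position, which forces degree at most one.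
  2≤deg⁻ : ∀ u → 2 ≤ deg u → toℕ u ≢ 0 × suc (toℕ u) < n
  2≤deg⁻ u 2≤deg = notFirst , ≤∧≢⇒< (toℕ<n u) notLast
    where
    notFirst : toℕ u ≢ 0
    notFirst u≡0 = <⇒≱ 2≤deg (∣p∣≤1 (N u) λ x∈ y∈ →
      toℕ-injective (trans (neighbour (∈N⁻ (path n) x∈)) (sym (neighbour (∈N⁻ (path n) y∈)))))
      where
      neighbour : ∀ {x} → Adj u x → toℕ x ≡ 1
      neighbour (inj₁ e) = trans e (cong suc u≡0)
      neighbour (inj₂ e) with trans (sym e) u≡0
      ... | ()
    notLast : suc (toℕ u) ≢ n
    notLast last = <⇒≱ 2≤deg (∣p∣≤1 (N u) λ x∈ y∈ →
      toℕ-injective (suc-injective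
        (trans (sym (neighbour (∈N⁻ (path n) x∈))) (neighbour (∈N⁻ (path n) y∈)))))
      where
      neighbour : ∀ {x} → Adj u x → toℕ u ≡ suc (toℕ x)
      neighbour {x} (inj₁ e) = ⊥-elim (<⇒≱ (toℕ<n x) (≤-reflexive (trans (sym last) (sym e))))
      neighbour     (inj₂ e) = e

  2≤deg⁺ : ∀ {u v w} → toℕ u ≡ suc (toℕ v) → toℕ w ≡ suc (toℕ u) → 2 ≤ deg u
  2≤deg⁺ {u} {v} {w} u≡1+v w≡1+u =
    2≤∣p∣ (N u) (∈N⁺ (path n) {v = u} {w = v} (inj₂ u≡1+v))
                (∈N⁺ (path n) {v = u} {w = w} (inj₁ w≡1+u)) w≢v
    where
    w≢v : w ≢ v
    w≢v refl = m≢1+n+m (toℕ w) (trans w≡1+u (cong suc u≡1+v))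

-- The witness `v` is the vertex just after or just before `u`, which selects the disjunct. The far
-- neighbour of `v` must lie in `S`, or it is off the path and reads as true.
IsESD⇒Local : (S : Subset n) → IsESD (path n) S → Local (true ∷ true ∷ S)
IsESD⇒Local {n} S esd i eq with bit-false⇒vertex S i eq
... | u , refl , u∉S with esd u u∉S
... | (v , v∈S , N≡) , 2≤deg with N∩∁≡⁅⁆⁻ (path n) {S} {u} {v} N≡
... | vu , only = proj₂ (2≤deg⁻ u 2≤deg) , side vu
  where
  open Graph (path n)
  P : Vec Bool (2 + n)
  P = true ∷ true ∷ S
  side : Adj v u →
         (bit S (1 + toℕ u) ≡ true × bit S (2 + toℕ u) ≡ true) ⊎
         (bit P (1 + toℕ u) ≡ true × bit P (toℕ u) ≡ true)
  side (inj₂ v≡1+u) = inj₁ (trans (cong (bit S) (sym v≡1+u)) (bit-∈ v∈S) , beyond)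
    where
    beyond : bit S (2 + toℕ u) ≡ true
    beyond with bit S (2 + toℕ u) in eq₂
    ... | true  = refl
    ... | false with bit-false⇒vertex S _ eq₂
    ... | w , w≡2+u , w∉S
      with only {w} (inj₁ (trans w≡2+u (cong suc (sym v≡1+u)))) w∉S
    ... | refl = ⊥-elim (m≢1+n+m (toℕ u) w≡2+u)
  side (inj₁ u≡1+v) = inj₂ (trans (cong (bit (true ∷ S)) u≡1+v) (bit-∈ v∈S) ,
                            trans (cong (bit P) u≡1+v) (beyond _ refl))
    where
    beyond : ∀ j → j ≡ toℕ v → bit (true ∷ S) j ≡ true
    -- Here `v` is the first vertex, and the bit before it is padding.
    beyond zero    _    = refl
    beyond (suc j) 1+j≡v with bit S j in eq₂
    ... | true  = refl
    ... | false with bit-false⇒vertex S j eq₂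
    ... | w , refl , w∉S with only {w} (inj₂ (sym 1+j≡v)) w∉S
    ... | refl = ⊥-elim (m≢1+n+m (toℕ u) (trans u≡1+v (cong suc (sym 1+j≡v))))

-- The padding alone would match a false first bit, hence the hypothesis `first`; at the right end
-- the strict inequality inside `Local` excludes the last vertex.
Local⇒IsESD : (S : Subset (suc n)) → bit S 0 ≡ true → Local (true ∷ true ∷ S) →
              IsESD (path (suc n)) S
Local⇒IsESD {n} S first loc u u∉S with bit-∁ u∉S
Local⇒IsESD {n} S first loc zero u∉S | u-false with trans (sym first) u-false
... | ()
Local⇒IsESD {n} S first loc u@(suc u′) u∉S | u-false with loc (toℕ u) u-false
... | 1+u<n , ok = dominated ok , 2≤deg⁺ u≡1+v r≡1+u
  where
  open Graph (path (suc n))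
  l r : Fin (suc n)
  l = inject₁ u′
  r = fromℕ< 1+u<n
  u≡1+v : toℕ u ≡ suc (toℕ l)
  u≡1+v = cong suc (sym (toℕ-inject₁ u′))
  r≡1+u : toℕ r ≡ suc (toℕ u)
  r≡1+u = toℕ-fromℕ< 1+u<n
  contra : ∀ {w i} {A : Set} → w ∈ ∁ S → toℕ w ≡ i → bit S i ≡ true → A
  contra w∉S refl t with trans (sym t) (bit-∁ w∉S)
  ... | ()
  dominated : (bit S (1 + toℕ u) ≡ true × bit S (2 + toℕ u) ≡ true) ⊎
              (bit S (toℕ u′) ≡ true × bit (true ∷ S) (toℕ u′) ≡ true) →
              ∃[ v ] v ∈ S × N v ∩ ∁ S ≡ ⁅ u ⁆
  dominated (inj₁ (t₁ , t₂)) =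
    r , ∈-bit S r (trans (cong (bit S) r≡1+u) t₁) ,
    N∩∁≡⁅⁆⁺ (path (suc n)) {S} {u} {r} (inj₂ r≡1+u) u∉S only
    where
    only : ∀ {w} → Adj r w → w ∈ ∁ S → w ≡ u
    only (inj₁ e) w∉S = contra w∉S (trans e (cong suc r≡1+u)) t₂
    only (inj₂ e) _   = toℕ-injective (suc-injective (trans (sym e) r≡1+u))
  dominated (inj₂ (t₁ , t₂)) =
    l , ∈-bit S l (trans (cong (bit S) (suc-injective (sym u≡1+v))) t₁) ,
    N∩∁≡⁅⁆⁺ (path (suc n)) {S} {u} {l} (inj₁ u≡1+v) u∉S only
    where
    only : ∀ {w} → Adj l w → w ∈ ∁ S → w ≡ u
    only     (inj₁ e) _   = toℕ-injective (trans e (sym u≡1+v))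
    only {w} (inj₂ e) w∉S = contra w∉S refl
      (subst (λ j → bit (true ∷ S) j ≡ true) (trans (suc-injective u≡1+v) e) t₂)

-- Counting true bits: the lower bound.

-- The least number of true bits among the last m vertices of the path on
-- 1 + m vertices, the first vertex being always in S.
minRest : ℕ → ℕ
minRest 0 = 0
minRest 1 = 1
minRest 2 = 1
minRest 3 = 1
minRest (suc (suc (suc (suc m)))) = 2 + minRest m

-- Pays for reading `true` in context `true true`, which leaves the context unchanged.
minRest-suc : ∀ m → minRest (suc m) ≤ suc (minRest m)
minRest-suc 0 = s≤s z≤n
minRest-suc 1 = s≤s z≤n
minRest-suc 2 = s≤s z≤n
minRest-suc 3 = ≤-refl
minRest-suc (suc (suc (suc (suc m)))) = s≤s (s≤s (minRest-suc m))

-- Passage from context `true true` to `false true`: the `suc` is the true bit just read, the rest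
-- is the bound in the new context.
minRest-2+ : ∀ m → minRest (2 + m) ≤ suc ⌈ m /2⌉
minRest-2+ 0 = ≤-refl
minRest-2+ 1 = s≤s z≤n
minRest-2+ 2 = ≤-refl
minRest-2+ 3 = ≤-refl
minRest-2+ (suc (suc (suc (suc m)))) = s≤s (s≤s (minRest-2+ m))

-- Passage back to context `true true`: one true bit closes the gap between the two bounds.
⌈1+m/2⌉≤1+minRest : ∀ m → ⌈ suc m /2⌉ ≤ suc (minRest m)
⌈1+m/2⌉≤1+minRest 0 = ≤-refl
⌈1+m/2⌉≤1+minRest 1 = s≤s z≤n
⌈1+m/2⌉≤1+minRest 2 = ≤-refl
⌈1+m/2⌉≤1+minRest 3 = ≤-refl
⌈1+m/2⌉≤1+minRest (suc (suc (suc (suc m)))) = s≤s (s≤s (⌈1+m/2⌉≤1+minRest m))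

-- With `k * 4` on the left of the sum, each block of four unfolds definitionally.
minRest-*4+ : ∀ k r → minRest (k * 4 + r) ≡ k * 2 + minRest r
minRest-*4+ zero    r = refl
minRest-*4+ (suc k) r = cong (2 +_) (minRest-*4+ k r)

-- After "false true" the next false bit must be matched to its right, which
-- costs the deficit that "true true" would still allow.
mutual
  Local-tt : (bs : Vec Bool m) → Local (true ∷ true ∷ bs) → minRest m ≤ ∣ bs ∣
  Local-tt []                  loc = z≤n
  Local-tt {suc m} (true ∷ bs) loc =
    ≤-trans (minRest-suc m) (s≤s (Local-tt bs (Local-tail loc)))
  Local-tt (false ∷ [])        loc with loc 0 refl
  ... | s<s () , _
  Local-tt {suc (suc m)} (false ∷ true ∷ bs) loc =
    ≤-trans (minRest-2+ m) (s≤s (Local-ft bs (Local-tail (Local-tail loc))))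
  Local-tt (false ∷ false ∷ []) loc with loc 1 refl
  ... | s<s (s<s ()) , _
  Local-tt (false ∷ false ∷ false ∷ _) loc with loc 1 refl
  ... | _ , inj₁ (() , _)
  ... | _ , inj₂ (() , _)
  Local-tt (false ∷ false ∷ true ∷ []) loc = ≤-refl
  Local-tt (false ∷ false ∷ true ∷ false ∷ _) loc with loc 1 refl
  ... | _ , inj₁ (_ , ())
  ... | _ , inj₂ (() , _)
  -- The optimal block: two true bits out of four, with the context restored, exactly as in the
  -- recursion of `minRest`.
  Local-tt (false ∷ false ∷ true ∷ true ∷ bs) loc =
    s≤s (s≤s (Local-tt bs (Local-tail (Local-tail (Local-tail (Local-tail loc))))))

  Local-ft : (bs : Vec Bool m) → Local (false ∷ true ∷ bs) → ⌈ m /2⌉ ≤ ∣ bs ∣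
  Local-ft []                  loc = z≤n
  Local-ft {suc m} (true ∷ bs) loc =
    ≤-trans (⌈1+m/2⌉≤1+minRest m) (s≤s (Local-tt bs (Local-tail loc)))
  Local-ft (false ∷ []) loc with loc 0 refl
  ... | s<s () , _
  Local-ft (false ∷ false ∷ _) loc with loc 0 refl
  ... | _ , inj₁ (() , _)
  ... | _ , inj₂ (_ , ())
  Local-ft (false ∷ true ∷ []) loc = ≤-refl
  Local-ft (false ∷ true ∷ false ∷ _) loc with loc 0 refl
  ... | _ , inj₁ (_ , ())
  ... | _ , inj₂ (_ , ())
  -- Matching to the right spends two true bits on one false bit and returns to context `true true`.
  Local-ft {suc (suc (suc m))} (false ∷ true ∷ true ∷ bs) loc =
    s≤s (≤-trans (⌈1+m/2⌉≤1+minRest m)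
                 (s≤s (Local-tt bs (Local-tail (Local-tail (Local-tail loc))))))

-- A word attaining the bound.

-- Preceded by the first vertex, this repeats `true false false true`; every leftover is arranged so
-- that the last vertex is in the set.
optimal : ∀ m → Vec Bool m
optimal 0 = []
optimal 1 = true ∷ []
optimal 2 = false ∷ true ∷ []
optimal 3 = false ∷ false ∷ true ∷ []
optimal (suc (suc (suc (suc m)))) = false ∷ false ∷ true ∷ true ∷ optimal m

∣optimal∣ : ∀ m → ∣ optimal m ∣ ≡ minRest m
∣optimal∣ 0 = refl
∣optimal∣ 1 = refl
∣optimal∣ 2 = refl
∣optimal∣ 3 = refl
∣optimal∣ (suc (suc (suc (suc m)))) = cong (2 +_) (∣optimal∣ m)

optimal-Local : ∀ m → Local (true ∷ true ∷ optimal m)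
optimal-Local 1 zero ()
optimal-Local 2 zero _ = ≤-refl , inj₂ (refl , refl)
optimal-Local 2 (suc zero) ()
optimal-Local 3 zero _ = s≤s (s≤s z≤n) , inj₂ (refl , refl)
optimal-Local 3 (suc zero) _ = ≤-refl , inj₁ (refl , refl)
optimal-Local 3 (suc (suc zero)) ()
optimal-Local (suc (suc (suc (suc m)))) zero _ = s≤s (s≤s z≤n) , inj₂ (refl , refl)
optimal-Local (suc (suc (suc (suc m)))) (suc zero) _ =
  s≤s (s≤s (s≤s z≤n)) , inj₁ (refl , refl)
optimal-Local (suc (suc (suc (suc m)))) (suc (suc zero)) ()
optimal-Local (suc (suc (suc (suc m)))) (suc (suc (suc zero))) ()
-- The block ends in `true true`, the left context that the recursive call assumes.
optimal-Local (suc (suc (suc (suc m)))) (suc (suc (suc (suc i)))) eq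
  with optimal-Local m i eq
... | i<m , ok = s<s (s<s (s<s (s<s i<m))) , ok

-- The end super domination number of the path.

IsESD-path⇒≤ : (S : Subset (suc m)) → IsESD (path (suc m)) S → suc (minRest m) ≤ ∣ S ∣
-- The left context is now one padding bit and the first vertex itself.
IsESD-path⇒≤ (true ∷ S) esd =
  s≤s (Local-tt S (Local-tail (IsESD⇒Local (true ∷ S) esd)))
IsESD-path⇒≤ {m} (false ∷ S) esd =
  ⊥-elim (proj₁ (2≤deg⁻ {suc m} zero (proj₂ (esd zero (∁-bit (false ∷ S) zero refl)))) refl)

γesp-path : ∀ m → γesp (path (suc m)) ≡ suc (minRest m)
γesp-path m with esdNumber (path (suc m))
... | _ , (S , esd , refl) , least′ = ≤-antisym
  (least′ _ (true ∷ optimal m ,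
             Local⇒IsESD (true ∷ optimal m) refl padded ,
             cong suc (∣optimal∣ m)))
  (IsESD-path⇒≤ S esd)
  where
  padded : Local (true ∷ true ∷ true ∷ optimal m)
  padded (suc i) eq with optimal-Local m i eq
  ... | i<m , ok = s<s i<m , ok

γesp-path-*4+ : ∀ {n} k r → n ≡ suc (k * 4 + r) → γesp (path n) ≡ suc (k * 2 + minRest r)
γesp-path-*4+ k r refl = trans (γesp-path (k * 4 + r)) (cong suc (minRest-*4+ k r))

theorem3p5 : (n k : ℕ) → 2 ≤ n →
    (n ≡ 4 * k → γesp (path n) ≡ 2 * k) ×
    (n ≡ 4 * k + 1 → γesp (path n) ≡ 2 * k + 1) ×
    (n ≡ 4 * k + 2 ⊎ n ≡ 4 * k + 3 → γesp (path n) ≡ 2 * k + 2)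
theorem3p5 n k 2≤n = case₀ k , case₁ , case₂₃
  where
  case₀ : ∀ k → n ≡ 4 * k → γesp (path n) ≡ 2 * k
  case₀ zero    eq with subst (2 ≤_) eq 2≤n
  ... | ()
  -- The first vertex takes one place, so `4 * suc k` leaves only `k` full blocks and remainder 3.
  case₀ (suc k) eq = trans (γesp-path-*4+ k 3 (trans eq (length k))) (size k)
    where
    length : ∀ k → 4 * suc k ≡ suc (k * 4 + 3)
    length = solve-∀
    size : ∀ k → suc (k * 2 + 1) ≡ 2 * suc k
    size = solve-∀
  case₁ : n ≡ 4 * k + 1 → γesp (path n) ≡ 2 * k + 1
  case₁ eq = trans (γesp-path-*4+ k 0 (trans eq (length k))) (size k)
    where
    length : ∀ k → 4 * k + 1 ≡ suc (k * 4 + 0)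
    length = solve-∀
    size : ∀ k → suc (k * 2 + 0) ≡ 2 * k + 1
    size = solve-∀
  size₂₃ : ∀ k → suc (k * 2 + 1) ≡ 2 * k + 2
  size₂₃ = solve-∀
  case₂₃ : n ≡ 4 * k + 2 ⊎ n ≡ 4 * k + 3 → γesp (path n) ≡ 2 * k + 2
  case₂₃ (inj₁ eq) = trans (γesp-path-*4+ k 1 (trans eq (length k))) (size₂₃ k)
    where
    length : ∀ k → 4 * k + 2 ≡ suc (k * 4 + 1)
    length = solve-∀
  case₂₃ (inj₂ eq) = trans (γesp-path-*4+ k 2 (trans eq (length k))) (size₂₃ k)
    where
    length : ∀ k → 4 * k + 3 ≡ suc (k * 4 + 2)
    length = solve-∀
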